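{- Let $\mathcal N$ be a sound deterministic negotiation diagram, let $n$ be a reachable node of $\mathcal N$, and let $\ell=(n,a)$ for some outcome $a$ of $n$. Then the negotiation diagram $\mathcal N|_\ell$ is sound and deterministic.
   Context: A negotiation diagram $\mathcal N$ is a tuple $(\mathrm{Proc},N,\mathrm{dom},R,\delta)$: $\mathrm{Proc}$ is a finite set of processes, $N$ a finite set of nodes, $\mathrm{dom}(n)\subseteq \mathrm{Proc}$ is a nonempty set for every node $n$, $R$ is a set of outcomes, each node $n$ has a set $\mathrm{out}(n)\subseteq R$ of outcomes, and for every $n\in N$, $a\in \mathrm{out}(n)$, $p\in\mathrm{dom}(n)$ a set $\delta(n,a,p)\subseteq N$ is given such that $p\in\mathrm{dom}(n')$ for all $n'\in\delta(n,a,p)$. There are two distinguished nodes $n_{init},n_{fin}$ with $\mathrm{dom}(n_{init})=\mathrm{dom}(n_{fin})=\mathrm{Proc}$. Every node except $n_{fin}$ has at least one outcome, and $n_{fin}$ has none. $\mathcal N$ is deterministic if every $\delta(n,a,p)$ is a singleton or empty. A location is a pair $\ell=(n,a)$ with $a\in\mathrm{out}(n)$; its domain is $\mathrm{dom}(n)$. A configuration is a map $C:\mathrm{Proc}\to\mathcal P(N)$. A node $n$ is enabled in $C$ if $n\in C(p)$ for all $p\in\mathrm{dom}(n)$. If $n$ is enabled in $C$ and $a\in \mathrm{out}(n)$ then $C\xrightarrow{(n,a)}C'$, where $C'(p)=\delta(n,a,p)$ for $p\in\mathrm{dom}(n)$ and $C'(p)=C(p)$ otherwise. A run from $C$ is a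 sequence $w$ of locations that can be executed successively from $C$; write $C\xrightarrow{w}C'$ if $w$ is finite and leads from $C$ to $C'$. $C_{init}(p)=\{n_{init}\}$ and $C_{fin}(p)=\{n_{fin}\}$ for all $p$. A run is successful if it starts in $C_{init}$ and ends in $C_{fin}$. $\mathcal N$ is sound if every finite run from $C_{init}$ can be extended to a successful run. A configuration is reachable if it is reachable from $C_{init}$ by a finite run; a node is reachable if it is enabled at some reachable configuration. A strict $n$-sequence is a finite sequence of locations whose domains are all included in $\mathrm{dom}(n)$ and, except possibly for the first location, strictly included in $\mathrm{dom}(n)$. For a reachable node $n$ of a sound deterministic $\mathcal N$ and $\ell=(n,a)$: $I(n)$ is the unique reachable configuration enabling $n$ and no other node; $F(\ell)$ is the unique configuration reachable from $I(n)$ by a strict $n$-sequence starting with $\ell$ such that no node enabled at $F(\ell)$ has domain strictly included in $\mathrm{dom}(n)$ (existence and uniqueness are known). The negotiation diagram $\mathcal N|_\ell$ has process set $\mathrm{dom}(n)$; it contains the node $n$, all nodes and locations that appear in the sequences $u$ such that $\ell u$ is a strict $n$-sequence and $I(n)\xrightarrow{\ell u}F(\ell)$ (with the domains they have in $\mathcal N$), plus a new final node $n|_\ell^{fin}$ with domain $\mathrm{dom}(n)$. Its initial node is $n$, which has $a$ as its unique outcome, and its transition function is $\delta|_\ell(m,b,p)=\delta(m,b,p)$ if $\delta(m,b,p)\ne F(\ell)(p)$, and $\delta|_\ell(m,b,p)=\{n|_\ell^{fin}\}$ otherwise. Thus every node of $\mathcal N|_\ell$ other than $n$ and the final node has domain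 strictly included in $\mathrm{dom}(n)$. -}

module Defs where

open import Data.Bool using (if_then_else_)
import Data.Bool.Properties as Bool
open import Data.Fin using (Fin; zero; suc)
open import Data.Fin.Subset using (Subset; outside; _∈_; _∉_; _⊆_; _⊂_; _⊄_; ⊥; ⁅_⁆; Nonempty; Empty)
open import Data.List using (List; []; _∷_; _++_)
import Data.List.Membership.Propositional as List
open import Data.List.Relation.Unary.All using (All)
open import Data.Nat using (ℕ; suc)
open import Data.Product using (∃; ∃-syntax; _×_; _,_; proj₁; proj₂)
open import Data.Sum using (_⊎_)
import Data.Empty as Empty
import Data.Unit as Unit
open import Data.Vec using (_∷_)
open import Data.Vec.Properties using (≡-dec)
open import Relation.Binary.PropositionalEquality using (_≡_; _≢_)
open import Relation.Nullary using (¬_; does)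

-- The finite sets of processes and of nodes are subsets of `Fin P` and `Fin K`,
-- so that a diagram on some of the processes and nodes of another one needs no
-- renumbering.  Node and outcome sets are predicates because membership in
-- those of `restrict` below is an existential statement over runs.
--
-- `dom`, `Out` and `δ` are total; `dom n` and `Out n` are only meaningful for
-- nodes `n`, and `δ n a p` only if moreover `Out n a` and `p ∈ dom n`.
record Diagram (P K : ℕ) (R : Set) : Set₁ where
  field
    procs  : Subset P
    IsNode : Fin K → Set
    dom    : Fin K → Subset P
    Out    : Fin K → R → Set
    δ      : Fin K → R → Fin P → Subset K
    init   : Fin K
    fin    : Fin K

record IsNegotiation {P K : ℕ} {R : Set} (N : Diagram P K R) : Set where
  open Diagram N
  field
    init-isNode  : IsNode init
    fin-isNode   : IsNode fin
    dom-⊆        : ∀ {n} → IsNode n → dom n ⊆ procs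
    dom-nonempty : ∀ {n} → IsNode n → Nonempty (dom n)
    dom-init     : dom init ≡ procs
    dom-fin      : dom fin ≡ procs
    δ-closed     : ∀ {n a p m} → IsNode n → Out n a → p ∈ dom n →
                   m ∈ δ n a p → IsNode m × p ∈ dom m
    out-nonempty : ∀ {n} → IsNode n → n ≢ fin → ∃ (Out n)
    out-fin      : ∀ {a} → ¬ Out fin a

module _ {P K : ℕ} {R : Set} (N : Diagram P K R) where
  open Diagram N

  Deterministic : Set
  Deterministic = ∀ {n a p} → IsNode n → Out n a → p ∈ dom n →
                  (∃[ m ] δ n a p ≡ ⁅ m ⁆) ⊎ Empty (δ n a p)

  -- That the node and the outcome belong to the diagram is required in `Step`.
  Location : Set
  Location = Fin K × R

  -- Values at elements of `Fin P` outside `procs` are irrelevant.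
  Config : Set
  Config = Fin P → Subset K

  infix 4 _≈_
  _≈_ : Config → Config → Set
  C ≈ D = ∀ {p} → p ∈ procs → C p ≡ D p

  Enabled : Config → Fin K → Set
  Enabled C n = IsNode n × (∀ {p} → p ∈ dom n → n ∈ C p)

  record Step (C : Config) (ℓ : Location) (D : Config) : Set where
    private
      n = proj₁ ℓ
      a = proj₂ ℓ
    field
      enabled   : Enabled C n
      outcome   : Out n a
      moved     : ∀ {p} → p ∈ dom n → D p ≡ δ n a p
      unchanged : ∀ {p} → p ∈ procs → p ∉ dom n → D p ≡ C p

  data Run : Config → List Location → Config → Set where
    []  : ∀ {C D} → C ≈ D → Run C [] D
    _∷_ : ∀ {C D E ℓ w} → Step C ℓ D → Run D w E → Run C (ℓ ∷ w) E

  C-init C-fin : Config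
  C-init _ = ⁅ init ⁆
  C-fin  _ = ⁅ fin ⁆

  Successful : List Location → Set
  Successful w = Run C-init w C-fin

  Sound : Set
  Sound = ∀ w C → Run C-init w C → ∃[ w′ ] Successful (w ++ w′)

  Reachable : Config → Set
  Reachable C = ∃[ w ] Run C-init w C

  ReachableNode : Fin K → Set
  ReachableNode n = ∃[ C ] Reachable C × Enabled C n

  StrictSequence : Fin K → List Location → Set
  StrictSequence n []      = Unit.⊤
  StrictSequence n (ℓ ∷ w) =
    dom (proj₁ ℓ) ⊆ dom n × All (λ ℓ′ → dom (proj₁ ℓ′) ⊂ dom n) w

  -- `IsI n C` says that C is I(n).
  record IsI (n : Fin K) (C : Config) : Set where
    field
      reachable : Reachable C
      enabled   : Enabled C n
      only      : ∀ {m} → Enabled C m → m ≡ n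

  -- The sequences `ℓ u` with `ℓ = (n , a)` that lead strictly from I to F.
  StrictRun : (n : Fin K) (a : R) (I F : Config) → List Location → Set
  StrictRun n a I F u = StrictSequence n ((n , a) ∷ u) × Run I ((n , a) ∷ u) F

  -- `IsF n a I F` says that F is F(n , a), given that I is I(n).
  record IsF (n : Fin K) (a : R) (I F : Config) : Set where
    field
      reached : ∃ (StrictRun n a I F)
      maximal : ∀ {m} → Enabled F m → dom m ⊄ dom n

  Occurs : (n : Fin K) (a : R) (I F : Config) → Location → Set
  Occurs n a I F ℓ = ∃[ u ] StrictRun n a I F u × ℓ List.∈ u

  -- The diagram N|ℓ for `ℓ = (n , a)`, with I for I(n) and F for F(ℓ).  The new
  -- final node is `zero`, and `suc m` stands for the node m of N.
  restrict : (n : Fin K) (a : R) (I F : Config) → Diagram P (suc K) R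
  restrict n a I F = record
    { procs  = dom n
    ; IsNode = isNode
    ; dom    = dom′
    ; Out    = out
    ; δ      = δ′
    ; init   = suc n
    ; fin    = zero
    }
    where
    isNode : Fin (suc K) → Set
    isNode zero    = Unit.⊤
    isNode (suc m) = m ≡ n ⊎ (∃[ b ] Occurs n a I F (m , b))

    dom′ : Fin (suc K) → Subset P
    dom′ zero    = dom n
    dom′ (suc m) = dom m

    out : Fin (suc K) → R → Set
    out zero    b = Empty.⊥
    out (suc m) b = (m ≡ n × b ≡ a) ⊎ Occurs n a I F (m , b)

    δ′ : Fin (suc K) → R → Fin P → Subset (suc K)
    δ′ zero    b p = ⊥
    δ′ (suc m) b p =
      if does (≡-dec Bool._≟_ (δ m b p) (F p))
      then ⁅ zero ⁆
      else outside ∷ δ m b p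

module Submission where

-- A ranking assigns to nodes a memoryless choice of outcomes along which every process
-- moves to nodes of smaller rank; one is read off backwards from any successful run.
-- If p waits at m in a reachable configuration and q ∈ dom m is elsewhere, then following
-- the choices must bring q to m, so q has larger rank.  Hence nodes of maximal rank are
-- enabled, and two reachable configurations that agree off Z and whose enabled nodes all
-- involve processes off Z are equal: fire common nodes of maximal rank in both.
-- It follows that a maximal strict run may be replaced by one that follows the choices,
-- and by confluence of the latter F(ℓ) is the only configuration in which maximal strict
-- runs can end.  Moreover, a process p of an enabled strict node can be made to decrease
-- its rank, so that it is not yet in its position F(ℓ)(p).  Therefore runs of N|ℓ
-- correspond to strict runs of N, all of which extend to F(ℓ).

open import Defs
open import Data.Bool using (if_then_else_)
import Data.Bool.Properties as Bool
open import Data.Fin using (Fin; zero; suc; _≟_)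
open import Data.Fin.Properties using (all?; any?)
open import Data.Fin.Subset using (Subset; outside; _∈_; _∉_; _⊆_; _⊂_; ⁅_⁆; Nonempty; Empty)
open import Data.Fin.Subset.Properties using (_∈?_; _⊆?_; _⊂?_; nonempty?; x∈⁅x⁆; x∈⁅y⁆⇒x≡y; ⊂-irref)
open import Data.List using (List; []; _∷_; _++_; map; filter; allFin)
import Data.List.Membership.Propositional as List
open import Data.List.Membership.Propositional.Properties using (∈-filter⁺; ∈-filter⁻; ∈-allFin; ∈-++⁺ʳ)
open import Data.List.Properties using (++-identityʳ)
open import Data.List.Extrema.Nat using (argmax; argmax-all; f[xs]≤f[argmax])
open import Data.List.Relation.Unary.All as All using (All; []; _∷_)
open import Data.List.Relation.Unary.All.Properties using (++⁺; ++⁻ˡ; ++⁻ʳ)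
open import Data.List.Relation.Unary.Any using (here; there)
open import Data.Maybe using (Maybe; just; nothing)
open import Data.Maybe.Properties using (just-injective)
open import Data.Nat as ℕ using (ℕ; suc; z≤n; s≤s; _≤_; _<_; _⊔_)
open import Data.Nat.Induction using (Acc; acc; <-wellFounded)
import Data.Nat.Properties as ℕ
open import Data.Nat.ListAction using (sum)
open import Data.Empty using (⊥-elim)
open import Data.Product using (∃; ∃-syntax; _×_; _,_; proj₁; proj₂)
open import Data.Sum using (_⊎_; inj₁; inj₂; [_,_]′)
open import Data.Vec using (_∷_; there)
open import Data.Vec.Properties using (≡-dec)
open import Function using (_∘_; id)
open import Relation.Binary.PropositionalEquality
  using (_≡_; _≢_; refl; sym; trans; cong; subst; subst₂)
open import Relation.Nullary using (¬_; Dec; yes; no; does; contradiction)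
open import Relation.Nullary.Decidable using (dec-true; dec-false; _×-dec_; _→-dec_; ¬?)
open import Relation.Unary using (Decidable)

-- Finite subsets and sums over lists.

⁅⁆-injective : ∀ {n} {x y : Fin n} → ⁅ x ⁆ ≡ ⁅ y ⁆ → x ≡ y
⁅⁆-injective {x = x} {y} eq = x∈⁅y⁆⇒x≡y y (subst (x ∈_) eq (x∈⁅x⁆ x))

∈-singleton : ∀ {n} {x y : Fin n} {s} → s ≡ ⁅ y ⁆ → x ∈ s → x ≡ y
∈-singleton {y = y} refl = x∈⁅y⁆⇒x≡y y

singleton-∋ : ∀ {n} {x : Fin n} {s} → s ≡ ⁅ x ⁆ → x ∈ s
singleton-∋ {x = x} refl = x∈⁅x⁆ x

⊈⇒∃∉ : ∀ {n} {s t : Subset n} → ¬ s ⊆ t → ∃[ x ] x ∈ s × x ∉ t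
⊈⇒∃∉ {s = s} {t} s⊈t with any? (λ x → (x ∈? s) ×-dec ¬? (x ∈? t))
... | yes found = found
... | no none   = ⊥-elim (s⊈t s⊆t)
  where
  s⊆t : s ⊆ t
  s⊆t {x} x∈s with x ∈? t
  ... | yes x∈t = x∈t
  ... | no  x∉t = contradiction (x , x∈s , x∉t) none

infix 4 _≟ˢ_
_≟ˢ_ : ∀ {n} (s t : Subset n) → Dec (s ≡ t)
_≟ˢ_ = ≡-dec Bool._≟_

module _ {A : Set} {f g : A → ℕ} where

  sum-map-≤ : ∀ xs → (∀ {x} → x List.∈ xs → f x ≤ g x) → sum (map f xs) ≤ sum (map g xs)
  sum-map-≤ []       f≤g = z≤n
  sum-map-≤ (x ∷ xs) f≤g = ℕ.+-mono-≤ (f≤g (here refl)) (sum-map-≤ xs (f≤g ∘ there))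

  sum-map-< : ∀ {y xs} → (∀ {x} → x List.∈ xs → f x ≤ g x) → y List.∈ xs → f y < g y →
              sum (map f xs) < sum (map g xs)
  sum-map-< {xs = x ∷ xs} f≤g (here refl) fy<gy = ℕ.+-mono-<-≤ fy<gy (sum-map-≤ xs (f≤g ∘ there))
  sum-map-< {xs = x ∷ xs} f≤g (there y∈)  fy<gy = ℕ.+-mono-≤-< (f≤g (here refl)) (sum-map-< (f≤g ∘ there) y∈ fy<gy)

-- Runs in an arbitrary negotiation diagram.

module Runs {P K : ℕ} {R : Set} {N : Diagram P K R} (isN : IsNegotiation N) where
  open Diagram N
  open IsNegotiation isN
  open Step

  infix 4 _≋_
  _≋_ : Config N → Config N → Set
  _≋_ = _≈_ N

  step-resp : ∀ {C C′ D D′ ℓ} → Step N C ℓ D → C ≋ C′ → D ≋ D′ → Step N C′ ℓ D′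
  step-resp {ℓ = m , _} s C≋C′ D≋D′ = record
    { enabled   = proj₁ (enabled s) ,
                  λ p∈m → subst (m ∈_) (C≋C′ (dom-⊆ (proj₁ (enabled s)) p∈m)) (proj₂ (enabled s) p∈m)
    ; outcome   = outcome s
    ; moved     = λ p∈m → trans (sym (D≋D′ (dom-⊆ (proj₁ (enabled s)) p∈m))) (moved s p∈m)
    ; unchanged = λ p∈ p∉m → trans (sym (D≋D′ p∈)) (trans (unchanged s p∈ p∉m) (C≋C′ p∈))
    }

  run-respˡ : ∀ {C C′ D w} → Run N C w D → C ≋ C′ → Run N C′ w D
  run-respˡ ([] C≋D) C≋C′ = [] λ p∈ → trans (sym (C≋C′ p∈)) (C≋D p∈)
  run-respˡ (s ∷ r)  C≋C′ = step-resp s C≋C′ (λ _ → refl) ∷ r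

  run-++ : ∀ {C D E v w} → Run N C v D → Run N D w E → Run N C (v ++ w) E
  run-++ ([] C≋D) r′ = run-respˡ r′ λ p∈ → sym (C≋D p∈)
  run-++ (s ∷ r)  r′ = s ∷ run-++ r r′

  step-functional : ∀ {C C′ D D′ ℓ} → Step N C ℓ D → Step N C′ ℓ D′ → C ≋ C′ → D ≋ D′
  step-functional {ℓ = m , _} s s′ C≋C′ {p} p∈ with p ∈? dom m
  ... | yes p∈m = trans (moved s p∈m) (sym (moved s′ p∈m))
  ... | no  p∉m = trans (unchanged s p∈ p∉m) (trans (C≋C′ p∈) (sym (unchanged s′ p∈ p∉m)))

  -- Runs are functional up to `_≋_`, so a prefix can be cut off. This turns an extension given by
  -- soundness into a run from the configuration already reached.
  run-residual : ∀ {C C′ D E v w} → Run N C v D → Run N C′ (v ++ w) E → C ≋ C′ → Run N D w E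
  run-residual ([] C≋D) r′ C≋C′ = run-respˡ r′ λ p∈ → trans (sym (C≋C′ p∈)) (C≋D p∈)
  run-residual (s ∷ r) (s′ ∷ r′) C≋C′ = run-residual r r′ (step-functional s s′ C≋C′)

  fire : Config N → Fin K → R → Config N
  fire C m b p = if does (p ∈? dom m) then δ m b p else C p

  fire-∈ : ∀ C {m b p} → p ∈ dom m → fire C m b p ≡ δ m b p
  fire-∈ C {m} {b} {p} p∈m rewrite dec-true (p ∈? dom m) p∈m = refl

  fire-∉ : ∀ C {m b p} → p ∉ dom m → fire C m b p ≡ C p
  fire-∉ C {m} {b} {p} p∉m rewrite dec-false (p ∈? dom m) p∉m = refl

  fire-step : ∀ {C m b} → Enabled N C m → Out m b → Step N C (m , b) (fire C m b)
  fire-step {C} en out = record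
    { enabled   = en
    ; outcome   = out
    ; moved     = fire-∈ C
    ; unchanged = λ _ → fire-∉ C
    }

  reachable-run : ∀ {C D w} → Reachable N C → Run N C w D → Reachable N D
  reachable-run (v , r) r′ = v ++ _ , run-++ r r′

  reachable-step : ∀ {C D ℓ} → Reachable N C → Step N C ℓ D → Reachable N D
  reachable-step reach s = reachable-run reach (s ∷ [] (λ _ → refl))

  location-valid : ∀ {C D w m b} → Run N C w D → (m , b) List.∈ w → IsNode m × Out m b
  location-valid (s ∷ r) (here refl) = proj₁ (enabled s) , outcome s
  location-valid (s ∷ r) (there ∈w)  = location-valid r ∈w

  stays-or-moves : ∀ {C D w p} → Run N C w D → p ∈ procs →
    C p ≡ D p ⊎ ∃[ m ] ∃[ b ] (m , b) List.∈ w × m ∈ C p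
  stays-or-moves ([] C≋D) p∈ = inj₁ (C≋D p∈)
  stays-or-moves {p = p} (_∷_ {ℓ = m , b} s r) p∈ with p ∈? dom m
  ... | yes p∈m = inj₂ (m , b , here refl , proj₂ (enabled s) p∈m)
  ... | no  p∉m with unchanged s p∈ p∉m | stays-or-moves r p∈
  ... | D≡C | inj₁ D≡E                  = inj₁ (trans (sym D≡C) D≡E)
  ... | D≡C | inj₂ (k , c , ∈w , k∈D)   = inj₂ (k , c , there ∈w , subst (k ∈_) D≡C k∈D)

  -- The witness `k` is the next node in which `p` takes part. The dichotomy will show that
  -- transitions of N|ℓ stay within N|ℓ.
  stays-or-moves-after : ∀ {C D w m b p} → Run N C w D → p ∈ procs → (m , b) List.∈ w → p ∈ dom m →
    δ m b p ≡ D p ⊎ ∃[ k ] ∃[ c ] (k , c) List.∈ w × k ∈ δ m b p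
  stays-or-moves-after (s ∷ r) p∈ (here refl) p∈m with moved s p∈m | stays-or-moves r p∈
  ... | D≡δ | inj₁ D≡E                = inj₁ (trans (sym D≡δ) D≡E)
  ... | D≡δ | inj₂ (k , c , ∈w , k∈D) = inj₂ (k , c , there ∈w , subst (k ∈_) D≡δ k∈D)
  stays-or-moves-after (s ∷ r) p∈ (there ∈w) p∈m with stays-or-moves-after r p∈ ∈w p∈m
  ... | inj₁ eq                 = inj₁ eq
  ... | inj₂ (k , c , ∈w′ , k∈) = inj₂ (k , c , there ∈w′ , k∈)

  Determined : Config N → Set
  Determined C = ∀ {p} → p ∈ procs → (∃[ m ] C p ≡ ⁅ m ⁆) ⊎ Empty (C p)

  determined-at : ∀ {C m p} → Determined C → p ∈ procs → m ∈ C p → C p ≡ ⁅ m ⁆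
  determined-at {m = m} det p∈ m∈ with det p∈
  ... | inj₁ (k , eq) = trans eq (cong ⁅_⁆ (sym (∈-singleton eq m∈)))
  ... | inj₂ empty    = contradiction (m , m∈) empty

  determined-step : Deterministic N → ∀ {C D ℓ} → Step N C ℓ D → Determined C → Determined D
  determined-step det {C} {D} {m , b} s detC {p} p∈ with p ∈? dom m
  ... | yes p∈m rewrite moved s p∈m        = det (proj₁ (enabled s)) (outcome s) p∈m
  ... | no  p∉m rewrite unchanged s p∈ p∉m = detC p∈

  determined-run : Deterministic N → ∀ {C D w} → Run N C w D → Determined C → Determined D
  determined-run det ([] C≋D) detC p∈ rewrite sym (C≋D p∈) = detC p∈
  determined-run det (s ∷ r)  detC = determined-run det r (determined-step det s detC)

  -- A process shared by `m` and `m′` would wait at both although `C` is determined; so the domains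
  -- are disjoint and the steps commute.
  diamond : ∀ {C D D′ m m′ b b′} → Determined C → m ≢ m′ → Step N C (m , b) D → Step N C (m′ , b′) D′ →
    ∃[ E ] Step N D (m′ , b′) E × Step N D′ (m , b) E
  diamond {C} {D} {D′} {m} {m′} {b} {b′} det m≢m′ s s′ = E , t , t′
    where
    E = fire D m′ b′
    disjoint : ∀ {p} → p ∈ dom m → p ∉ dom m′
    disjoint p∈m p∈m′ = m≢m′ (∈-singleton
      (determined-at {C} det (dom-⊆ (proj₁ (enabled s′)) p∈m′) (proj₂ (enabled s′) p∈m′)) (proj₂ (enabled s) p∈m))
    t : Step N D (m′ , b′) E
    t = fire-step (proj₁ (enabled s′) , λ p∈m′ → subst (m′ ∈_)
          (sym (unchanged s (dom-⊆ (proj₁ (enabled s′)) p∈m′) λ p∈m → disjoint p∈m p∈m′))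
          (proj₂ (enabled s′) p∈m′)) (outcome s′)
    t′ : Step N D′ (m , b) E
    t′ = record
      { enabled   = proj₁ (enabled s) , λ p∈m → subst (m ∈_)
          (sym (unchanged s′ (dom-⊆ (proj₁ (enabled s)) p∈m) (disjoint p∈m))) (proj₂ (enabled s) p∈m)
      ; outcome   = outcome s
      ; moved     = λ p∈m → trans (fire-∉ D (disjoint p∈m)) (moved s p∈m)
      ; unchanged = unchanged′
      }
      where
      unchanged′ : ∀ {p} → p ∈ procs → p ∉ dom m → E p ≡ D′ p
      unchanged′ {p} p∈ p∉m with p ∈? dom m′
      ... | yes p∈m′ = sym (moved s′ p∈m′)
      ... | no  p∉m′ = trans (unchanged s p∈ p∉m) (sym (unchanged s′ p∈ p∉m′))

  Maximal : (Fin K → Set) → Config N → Set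
  Maximal Q C = ∀ {m} → Enabled N C m → ¬ Q m

  Closed : (Fin K → Set) → Set
  Closed Q = ∀ {m k} → Q m → dom k ⊆ dom m → Q k

-- Sound deterministic diagrams and rankings.

module SoundDeterministic {P K : ℕ} {R : Set} {N : Diagram P K R} (isN : IsNegotiation N)
                          (sound : Sound N) (deterministic : Deterministic N) where
  open Diagram N
  open IsNegotiation isN
  open Step
  open Runs isN

  determined : ∀ {C} → Reachable N C → Determined C
  determined (w , r) = determined-run deterministic r λ _ → inj₁ (init , refl)

  completes : ∀ {C} → Reachable N C → ∃[ w ] Run N C w (C-fin N)
  completes (v , r) with sound v _ r
  ... | w , r′ = w , run-residual r r′ λ _ → refl

  fin-or-enabled : ∀ {C} → Reachable N C → C ≋ C-fin N ⊎ ∃[ m ] ∃[ b ] Enabled N C m × Out m b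
  fin-or-enabled reach with completes reach
  ... | _ , [] C≋fin = inj₁ C≋fin
  ... | (m , b) ∷ _ , s ∷ _ = inj₂ (m , b , enabled s , outcome s)

  -- Ranks are defined on subsets of nodes so that they apply directly to the values
  -- of a configuration.
  record Ranking : Set where
    field
      choice     : Fin K → Maybe R
      rank       : Subset K → ℕ
      bound      : ℕ
      rank≤bound : ∀ s → rank s ≤ bound

    Ranked : Fin K → Set
    Ranked m = m ≡ fin ⊎ ∃[ b ] choice m ≡ just b

    field
      choice-node : ∀ {m b} → choice m ≡ just b → IsNode m
      choice-out  : ∀ {m b} → choice m ≡ just b → Out m b
      choice-next : ∀ {m b p} → choice m ≡ just b → p ∈ dom m →
                    ∃[ k ] δ m b p ≡ ⁅ k ⁆ × Ranked k × rank ⁅ k ⁆ < rank ⁅ m ⁆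

    ranked? : Decidable Ranked
    ranked? m with m ≟ fin
    ... | yes m≡fin = yes (inj₁ m≡fin)
    ... | no  m≢fin with choice m
    ...   | just b  = yes (inj₂ (b , refl))
    ...   | nothing = no λ { (inj₁ m≡fin) → m≢fin m≡fin ; (inj₂ (_ , ())) }

    ranked-node : ∀ {m} → Ranked m → IsNode m
    ranked-node (inj₁ refl)     = fin-isNode
    ranked-node (inj₂ (b , eq)) = choice-node eq

    ranked-choice : ∀ {m b} → Ranked m → Out m b → ∃[ c ] choice m ≡ just c
    ranked-choice (inj₁ refl) out = contradiction out out-fin
    ranked-choice (inj₂ c)    _   = c

  -- Following the choices of a ranking.

  module Strategy (ρ : Ranking) where
    open Ranking ρ

    Positioned : Config N → Set
    Positioned C = ∀ {p} → p ∈ procs → ∃[ k ] C p ≡ ⁅ k ⁆ × Ranked k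

    RankedRun : List (Location N) → Set
    RankedRun = All (Ranked ∘ proj₁)

    positioned-before : ∀ {C D m b} → Determined C → Step N C (m , b) D → Ranked m → Positioned D → Positioned C
    positioned-before {C} {m = m} det s ranked pos {p} p∈ with p ∈? dom m
    ... | yes p∈m = m , determined-at {C} det p∈ (proj₂ (enabled s) p∈m) , ranked
    ... | no  p∉m rewrite sym (unchanged s p∈ p∉m) = pos p∈

    run-positioned : ∀ {C D w} → Determined C → Run N C w D → RankedRun w → Positioned D → Positioned C
    run-positioned det ([] C≋D) []           pos p∈ rewrite C≋D p∈ = pos p∈
    run-positioned {C} det (s ∷ r)  (x ∷ ranked) pos =
      positioned-before {C} det s x (run-positioned (determined-step deterministic s det) r ranked pos)

    determined-positioned : ∀ {C} → Positioned C → Determined C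
    determined-positioned pos p∈ = let (k , eq , _) = pos p∈ in inj₁ (k , eq)

    positioned-at : ∀ {C m p} → Positioned C → p ∈ procs → m ∈ C p → C p ≡ ⁅ m ⁆ × Ranked m
    positioned-at pos p∈ m∈ with pos p∈
    ... | k , eq , ranked rewrite ∈-singleton eq m∈ = eq , ranked

    enabled-at : ∀ {C m p} → Positioned C → Enabled N C m → p ∈ dom m → C p ≡ ⁅ m ⁆ × Ranked m
    enabled-at {C} pos (node , en) p∈m = positioned-at {C} pos (dom-⊆ node p∈m) (en p∈m)

    enabled-ranked : ∀ {C m} → Positioned C → Enabled N C m → Ranked m
    enabled-ranked {C} pos en = proj₂ (enabled-at {C} pos en (proj₂ (dom-nonempty (proj₁ en))))

    -- `IsNode` need not be decidable. Once all three tests succeed, some process of `procs` waits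
    -- at `m`, so `m` is ranked and hence a node.
    enabled? : ∀ {C} → Positioned C → Decidable (Enabled N C)
    enabled? {C} pos m with dom m ⊆? procs | nonempty? (dom m) | all? (λ p → (p ∈? dom m) →-dec (m ∈? C p))
    ... | yes ⊆procs | yes (p , p∈m) | yes at =
      yes (ranked-node (proj₂ (positioned-at {C} pos (⊆procs p∈m) (at p p∈m))) , at _)
    ... | no ⊈procs | _        | _     = no λ en → ⊈procs (dom-⊆ (proj₁ en))
    ... | _         | no empty | _     = no λ en → empty (dom-nonempty (proj₁ en))
    ... | _         | _        | no ¬at = no λ en → ¬at λ _ → proj₂ en

    processes : List (Fin P)
    processes = filter (_∈? procs) (allFin P)

    ∈-processes : ∀ {p} → p ∈ procs → p List.∈ processes
    ∈-processes p∈ = ∈-filter⁺ (_∈? procs) (∈-allFin _) p∈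

    processes-∈ : ∀ {p} → p List.∈ processes → p ∈ procs
    processes-∈ p∈ = proj₂ (∈-filter⁻ (_∈? procs) {xs = allFin P} p∈)

    weight : Config N → ℕ
    weight C = sum (map (rank ∘ C) processes)

    module _ {C D m b} (pos : Positioned C) (s : Step N C (m , b) D) (chosen : choice m ≡ just b) where

      positioned-after : Positioned D
      positioned-after {p} p∈ with p ∈? dom m
      ... | yes p∈m rewrite moved s p∈m =
        let (k , eq , ranked , _) = choice-next chosen p∈m in k , eq , ranked
      ... | no  p∉m rewrite unchanged s p∈ p∉m = pos p∈

      rank-< : ∀ {p} → p ∈ dom m → rank (D p) < rank (C p)
      rank-< p∈m rewrite moved s p∈m | proj₁ (enabled-at {C} pos (enabled s) p∈m) with choice-next chosen p∈m
      ... | k , eq , _ , k<m rewrite eq = k<m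

      rank-≤ : ∀ {p} → p ∈ procs → rank (D p) ≤ rank (C p)
      rank-≤ {p} p∈ with p ∈? dom m
      ... | yes p∈m = ℕ.<⇒≤ (rank-< p∈m)
      ... | no  p∉m = ℕ.≤-reflexive (cong rank (unchanged s p∈ p∉m))

      weight-< : weight D < weight C
      weight-< with dom-nonempty (proj₁ (enabled s))
      ... | p , p∈m = sum-map-< (rank-≤ ∘ processes-∈) (∈-processes (dom-⊆ (proj₁ (enabled s)) p∈m)) (rank-< p∈m)

    -- Following the strategy, m eventually occurs, because p is waiting for it;
    -- the positions of q strictly decrease in rank until they reach m.
    waiting : ∀ {C m k p q} → Acc _<_ (weight C) → Reachable N C → Positioned C →
      p ∈ procs → q ∈ procs → q ∈ dom m → C p ≡ ⁅ m ⁆ → C q ≡ ⁅ k ⁆ → k ≡ m ⊎ rank ⁅ m ⁆ < rank ⁅ k ⁆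
    waiting {C} {m} {k} {p} {q} (acc rec) reach pos p∈ q∈ q∈m Cp Cq with fin-or-enabled reach
    ... | inj₁ C≋fin = inj₁ (⁅⁆-injective (trans (trans (sym Cq) (C≋fin q∈)) (trans (sym (C≋fin p∈)) Cp)))
    ... | inj₂ (e , b , en , out) with e ≟ m
    ...   | yes refl = inj₁ (sym (∈-singleton Cq (proj₂ en q∈m)))
    ...   | no  e≢m  with ranked-choice (enabled-ranked {C} pos en) out
    ...     | c , chosen = result
      where
      D = fire C e c
      s = fire-step en (choice-out chosen)
      posD = positioned-after pos s chosen
      Dp : D p ≡ ⁅ m ⁆
      Dp = trans (fire-∉ C λ p∈e → e≢m (∈-singleton Cp (proj₂ en p∈e))) Cp
      result : k ≡ m ⊎ rank ⁅ m ⁆ < rank ⁅ k ⁆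
      result with posD q∈
      ... | k′ , Dq , _
        with waiting (rec (weight-< pos s chosen)) (reachable-step reach s) posD p∈ q∈ q∈m Dp Dq | q ∈? dom e
      ...   | ih | no q∉e with ⁅⁆-injective (trans (sym Cq) (trans (sym (fire-∉ C q∉e)) Dq))
      ...     | refl = ih
      result | k′ , Dq , _ | ih | yes q∈e = inj₂ (ℕ.≤-<-trans m≤k′ k′<k)
        where
        m≤k′ : rank ⁅ m ⁆ ≤ rank ⁅ k′ ⁆
        m≤k′ = [ (λ eq → ℕ.≤-reflexive (cong (rank ∘ ⁅_⁆) (sym eq))) , ℕ.<⇒≤ ]′ ih
        k′<k : rank ⁅ k′ ⁆ < rank ⁅ k ⁆
        k′<k = subst (_< rank ⁅ k ⁆) (cong rank Dq) (subst (rank (D q) <_) (cong rank Cq) (rank-< pos s chosen q∈e))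

    -- A process of `dom m` positioned elsewhere would, by `waiting`, have a rank above the maximum.
    top-enabled : ∀ {C m p} → Reachable N C → Positioned C → p ∈ procs → C p ≡ ⁅ m ⁆ →
      (∀ {q} → q ∈ procs → rank (C q) ≤ rank ⁅ m ⁆) → Enabled N C m
    top-enabled {C} {m} {p} reach pos p∈ Cp top = node , at
      where
      node = ranked-node (proj₂ (positioned-at {C} pos p∈ (singleton-∋ Cp)))
      at : ∀ {q} → q ∈ dom m → m ∈ C q
      at q∈m with pos (dom-⊆ node q∈m)
      ... | k , Cq , _ with waiting (<-wellFounded _) reach pos p∈ (dom-⊆ node q∈m) q∈m Cp Cq
      ...   | inj₁ refl = singleton-∋ Cq
      ...   | inj₂ m<k  = contradiction (subst (λ s → rank s ≤ _) Cq (top (dom-⊆ node q∈m))) (ℕ.<⇒≱ m<k)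

    -- Configurations that agree off a set of processes.

    module _ (Z : Fin P → Set) where

      AgreeOff : Config N → Config N → Set
      AgreeOff C D = ∀ {p} → p ∈ procs → ¬ Z p → C p ≡ D p

      EnabledLeave : Config N → Set
      EnabledLeave C = ∀ {m} → Enabled N C m → ∃[ p ] p ∈ dom m × ¬ Z p

    -- The top node of `C` is enabled in `C`. By `leave` it has a process `q` off `Z`, which by
    -- agreement waits there in `D` too; as its rank also bounds those in `D`, it is enabled in `D`.
    common-enabled : ∀ {C D p} Z → Reachable N C → Reachable N D → Positioned C → Positioned D →
      AgreeOff Z C D → EnabledLeave Z C → p ∈ procs →
      (∀ {q} → q ∈ procs → rank (C q) ≤ rank (C p)) → (∀ {q} → q ∈ procs → rank (D q) ≤ rank (C p)) →
      ∃[ m ] Enabled N C m × Enabled N D m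
    common-enabled {C} {D} Z reachC reachD posC posD agree leave p∈ C≤ D≤ with posC p∈
    ... | m , Cp , _ rewrite Cp with top-enabled reachC posC p∈ Cp C≤
    ...   | en with leave en
    ...     | q , q∈m , ¬Zq = m , en , top-enabled reachD posD q∈ Dq D≤
      where
      q∈ = dom-⊆ (proj₁ en) q∈m
      Dq = trans (sym (agree q∈ ¬Zq)) (proj₁ (enabled-at {C} posC en q∈m))

    common-top : ∀ {C D} Z → Reachable N C → Reachable N D → Positioned C → Positioned D →
      AgreeOff Z C D → EnabledLeave Z C → EnabledLeave Z D → ∃[ m ] Enabled N C m × Enabled N D m
    common-top {C} {D} Z reachC reachD posC posD agree leaveC leaveD = by-total (ℕ.≤-total (rank (D p)) (rank (C p)))
      where
      p₀ = dom-nonempty init-isNode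
      f : Fin P → ℕ
      -- Maximising over both configurations makes the top rank of one a bound for the other; the
      -- side that attains it plays the role of `C` in `common-enabled`.
      f q = rank (C q) ⊔ rank (D q)
      p = argmax f (proj₁ p₀) processes
      p∈ : p ∈ procs
      p∈ = argmax-all f (dom-⊆ init-isNode (proj₂ p₀)) (All.tabulate processes-∈)
      f≤ : ∀ {q} → q ∈ procs → f q ≤ f p
      f≤ q∈ = All.lookup (f[xs]≤f[argmax] {f = f} (proj₁ p₀) processes) (∈-processes q∈)
      C≤ : ∀ {q} → q ∈ procs → rank (C q) ≤ f p
      C≤ q∈ = ℕ.≤-trans (ℕ.m≤m⊔n _ _) (f≤ q∈)
      D≤ : ∀ {q} → q ∈ procs → rank (D q) ≤ f p
      D≤ q∈ = ℕ.≤-trans (ℕ.m≤n⊔m _ _) (f≤ q∈)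
      by-total : rank (D p) ≤ rank (C p) ⊎ rank (C p) ≤ rank (D p) → ∃[ m ] Enabled N C m × Enabled N D m
      by-total (inj₁ D≤C) = common-enabled Z reachC reachD posC posD agree leaveC p∈
        (λ q∈ → subst (_ ≤_) (ℕ.m≥n⇒m⊔n≡m D≤C) (C≤ q∈)) (λ q∈ → subst (_ ≤_) (ℕ.m≥n⇒m⊔n≡m D≤C) (D≤ q∈))
      by-total (inj₂ C≤D) with common-enabled Z reachD reachC posD posC (λ q∈ ¬Z → sym (agree q∈ ¬Z)) leaveD p∈
        (λ q∈ → subst (_ ≤_) (ℕ.m≤n⇒m⊔n≡n C≤D) (D≤ q∈)) (λ q∈ → subst (_ ≤_) (ℕ.m≤n⇒m⊔n≡n C≤D) (C≤ q∈))
      ... | m , enD , enC = m , enC , enD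

    -- Induction on `weight C`. If the common node is `fin`, both configurations are final.
    -- Otherwise it fires in both, which removes `dom m` from `Z`; equality carries back because all
    -- of `dom m` waited at `m` in both.
    merge : ∀ {C D} Z → Acc _<_ (weight C) → Reachable N C → Reachable N D → Positioned C → Positioned D →
      AgreeOff Z C D → EnabledLeave Z C → EnabledLeave Z D → C ≋ D
    merge {C} {D} Z (acc rec) reachC reachD posC posD agree leaveC leaveD
      with common-top Z reachC reachD posC posD agree leaveC leaveD
    ... | m , enC , enD with enabled-ranked {C} posC enC
    ...   | inj₁ refl = λ p∈ → let p∈fin = subst (_ ∈_) (sym dom-fin) p∈ in
                          trans (proj₁ (enabled-at {C} posC enC p∈fin)) (sym (proj₁ (enabled-at {D} posD enD p∈fin)))
    ...   | inj₂ (b , chosen) = C≋D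
      where
      C′ = fire C m b
      D′ = fire D m b
      sC = fire-step enC (choice-out chosen)
      sD = fire-step enD (choice-out chosen)
      Z′ : Fin P → Set
      Z′ p = Z p × p ∉ dom m
      agree′ : AgreeOff Z′ C′ D′
      agree′ {p} p∈ ¬Z′ with p ∈? dom m
      ... | yes p∈m = refl
      ... | no  p∉m = agree p∈ λ Zp → ¬Z′ (Zp , p∉m)
      leave′ : ∀ E → EnabledLeave Z E → EnabledLeave Z′ (fire E m b)
      leave′ E leave {k} (node , en) with any? (λ p → (p ∈? dom k) ×-dec (p ∈? dom m))
      ... | yes (p , p∈k , p∈m) = p , p∈k , λ Z′p → proj₂ Z′p p∈m
      -- A node disjoint from `m` was already enabled before the step.
      ... | no disjoint with leave (node , λ {p} p∈k → subst (k ∈_) (fire-∉ E (λ p∈m → disjoint (p , p∈k , p∈m))) (en p∈k))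
      ...   | p , p∈k , ¬Zp = p , p∈k , ¬Zp ∘ proj₁
      C′≋D′ : C′ ≋ D′
      C′≋D′ = merge Z′ (rec (weight-< posC sC chosen)) (reachable-step reachC sC) (reachable-step reachD sD)
                (positioned-after posC sC chosen) (positioned-after posD sD chosen)
                agree′ (leave′ C leaveC) (leave′ D leaveD)
      C≋D : C ≋ D
      C≋D {p} p∈ with p ∈? dom m
      ... | yes p∈m = trans (proj₁ (enabled-at {C} posC enC p∈m)) (sym (proj₁ (enabled-at {D} posD enD p∈m)))
      ... | no  p∉m = trans (sym (fire-∉ C p∉m)) (trans (C′≋D′ p∈) (fire-∉ D p∉m))

    -- Runs along the choices and their confluence.

    record ChosenStep (Q : Fin K → Set) (C D : Config N) : Set where
      constructor chosen-step
      field
        {node}    : Fin K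
        {outcome} : R
        allowed   : Q node
        chosen    : choice node ≡ just outcome
        step      : Step N C (node , outcome) D

    data ChosenRun (Q : Fin K → Set) : Config N → Config N → Set where
      []  : ∀ {C D} → C ≋ D → ChosenRun Q C D
      _∷_ : ∀ {C D E} → ChosenStep Q C D → ChosenRun Q D E → ChosenRun Q C E

    chosen-respˡ : ∀ {Q C C′ D} → ChosenRun Q C D → C ≋ C′ → ChosenRun Q C′ D
    chosen-respˡ ([] C≋D) C≋C′ = [] λ p∈ → trans (sym (C≋C′ p∈)) (C≋D p∈)
    chosen-respˡ (chosen-step q eq s ∷ r) C≋C′ = chosen-step q eq (step-resp s C≋C′ (λ _ → refl)) ∷ r

    chosen-++ : ∀ {Q C D E} → ChosenRun Q C D → ChosenRun Q D E → ChosenRun Q C E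
    chosen-++ ([] C≋D) r′ = chosen-respˡ r′ λ p∈ → sym (C≋D p∈)
    chosen-++ (s ∷ r)  r′ = s ∷ chosen-++ r r′

    chosen-mono : ∀ {Q Q′ C D} → (∀ {m} → Q m → Q′ m) → ChosenRun Q C D → ChosenRun Q′ C D
    chosen-mono Q⇒Q′ ([] C≋D) = [] C≋D
    chosen-mono Q⇒Q′ (chosen-step q eq s ∷ r) = chosen-step (Q⇒Q′ q) eq s ∷ chosen-mono Q⇒Q′ r

    chosen-run : ∀ {Q C D} → ChosenRun Q C D → ∃[ w ] All (Q ∘ proj₁) w × Run N C w D
    chosen-run ([] C≋D) = [] , [] , [] C≋D
    chosen-run (chosen-step q eq s ∷ r) with chosen-run r
    ... | w , qs , r′ = _ ∷ w , q ∷ qs , s ∷ r′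

    chosen-reachable : ∀ {Q C D} → Reachable N C → ChosenRun Q C D → Reachable N D
    chosen-reachable reach r = reachable-run reach (proj₂ (proj₂ (chosen-run r)))

    chosen-positioned : ∀ {Q C D} → Positioned C → ChosenRun Q C D → Positioned D
    chosen-positioned pos ([] C≋D) p∈ rewrite sym (C≋D p∈) = pos p∈
    chosen-positioned pos (chosen-step q eq s ∷ r) = chosen-positioned (positioned-after pos s eq) r

    chosen-rank-≤ : ∀ {Q C D p} → Positioned C → ChosenRun Q C D → p ∈ procs → rank (D p) ≤ rank (C p)
    chosen-rank-≤ pos ([] C≋D) p∈ = ℕ.≤-reflexive (cong rank (sym (C≋D p∈)))
    chosen-rank-≤ pos (chosen-step q eq s ∷ r) p∈ =
      ℕ.≤-trans (chosen-rank-≤ (positioned-after pos s eq) r p∈) (rank-≤ pos s eq p∈)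

    chosen-unchanged : ∀ {Q C D p} → (∀ {m} → Q m → p ∉ dom m) → p ∈ procs → ChosenRun Q C D → D p ≡ C p
    chosen-unchanged p∉Q p∈ ([] C≋D) = sym (C≋D p∈)
    chosen-unchanged p∉Q p∈ (chosen-step q eq s ∷ r) =
      trans (chosen-unchanged p∉Q p∈ r) (unchanged s p∈ (p∉Q q))

    module _ {Q : Fin K → Set} (Q? : Decidable Q) (¬Q-fin : ¬ Q fin) where

      allowed-choice : ∀ {m} → Ranked m → Q m → ∃[ b ] choice m ≡ just b
      allowed-choice (inj₁ refl) q = contradiction q ¬Q-fin
      allowed-choice (inj₂ c)    q = c

      chosen-completion : ∀ {C} → Acc _<_ (weight C) → Positioned C → ∃[ D ] ChosenRun Q C D × Maximal Q D
      chosen-completion {C} (acc rec) pos with any? (λ m → enabled? {C} pos m ×-dec Q? m)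
      ... | no none = C , [] (λ _ → refl) , λ en q → none (_ , en , q)
      ... | yes (m , en , q) with allowed-choice (enabled-ranked {C} pos en) q
      ...   | b , eq with fire-step en (choice-out eq)
      ...     | s with chosen-completion (rec (weight-< pos s eq)) (positioned-after pos s eq)
      ...       | D , r , max = D , chosen-step q eq s ∷ r , max

    -- As `F` enables no node of `Q`, the run to `F` must fire the pending node at some point, with
    -- the same chosen outcome; `diamond` moves that step to the front.
    chosen-residual-step : ∀ {Q C D F} → Positioned C → ChosenRun Q C F → Maximal Q F →
      ChosenStep Q C D → ChosenRun Q D F
    chosen-residual-step {C = C} pos ([] C≋F) max (chosen-step q eq s) =
      contradiction q (max (enabled (step-resp s C≋F (λ _ → refl))))
    chosen-residual-step {C = C} pos (chosen-step {m} q eq s ∷ r) max (chosen-step {k} q′ eq′ s′) with m ≟ k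
    ... | yes refl with just-injective (trans (sym eq) eq′)
    ...   | refl = chosen-respˡ r (step-functional s s′ (λ _ → refl))
    chosen-residual-step {C = C} pos (chosen-step q eq s ∷ r) max (chosen-step q′ eq′ s′) | no m≢k
      with diamond (determined-positioned {C} pos) m≢k s s′
    ... | E , t , t′ =
      chosen-step q eq t′ ∷ chosen-residual-step (positioned-after pos s eq) r max (chosen-step q′ eq′ t)

    chosen-residual : ∀ {Q C D F} → Positioned C → ChosenRun Q C F → Maximal Q F →
      ChosenRun Q C D → ChosenRun Q D F
    chosen-residual pos r max ([] C≋D) = chosen-respˡ r C≋D
    chosen-residual pos r max (s@(chosen-step _ eq t) ∷ r′) =
      chosen-residual (positioned-after pos t eq) (chosen-residual-step pos r max s) max r′

    module _ {Q : Fin K → Set} (closed : Closed Q) (¬Q-fin : ¬ Q fin) where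

      -- A step of the run that deviates from the strategy at m only affects processes
      -- in dom m.  After completing both the actual and the chosen step inside dom m,
      -- every enabled node involves a process outside dom m, so that `merge` applies.
      follow-strategy : ∀ {C F w} → Reachable N C → Run N C w F → All (Q ∘ proj₁) w → RankedRun w →
        Positioned F → Maximal Q F → ChosenRun Q C F
      follow-strategy reach ([] C≋F) qs ranks posF max = [] C≋F
      follow-strategy {C} {F} reach (_∷_ {D = D} {ℓ = m , b} s r) (q ∷ qs) (ranked ∷ ranks) posF max
        with ranked-choice ranked (outcome s)
      ... | c , eq = chosen-step q eq s′ ∷
          chosen-++ (chosen-mono inside⇒Q C⇒D₂)
            -- By confluence the chosen run from `D` to `F` can pass through the completion of `D`
            -- inside `dom m`; its rest then also starts at the completion of `C′`.
            (chosen-respˡ (chosen-residual posD D⇒F max (chosen-mono inside⇒Q D⇒D₁)) D₁≋D₂)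
        where
        Inside : Fin K → Set
        Inside k = dom k ⊆ dom m
        inside⇒Q : ∀ {k} → Inside k → Q k
        inside⇒Q = closed q
        inside? : Decidable Inside
        inside? k = dom k ⊆? dom m
        ¬inside-fin : ¬ Inside fin
        ¬inside-fin = ¬Q-fin ∘ inside⇒Q
        C′ = fire C m c
        s′ = fire-step (enabled s) (choice-out eq)
        reachD = reachable-step reach s
        posD : Positioned D
        posD = run-positioned (determined reachD) r ranks posF
        posC : Positioned C
        posC = positioned-before {C} (determined reach) s ranked posD
        posC′ : Positioned C′
        posC′ = positioned-after posC s′ eq
        D⇒F : ChosenRun Q D F
        D⇒F = follow-strategy reachD r qs ranks posF max
        comp₁ = chosen-completion inside? ¬inside-fin (<-wellFounded (weight D)) posD
        comp₂ = chosen-completion inside? ¬inside-fin (<-wellFounded (weight C′)) posC′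
        D⇒D₁ = proj₁ (proj₂ comp₁)
        C⇒D₂ = proj₁ (proj₂ comp₂)
        leave : ∀ {E} → Maximal Inside E → EnabledLeave (_∈ dom m) E
        leave maxE en = ⊈⇒∃∉ (maxE en)
        agree : AgreeOff (_∈ dom m) (proj₁ comp₁) (proj₁ comp₂)
        agree {p} p∈ p∉m = trans (chosen-unchanged outside-inside p∈ D⇒D₁) (trans (unchanged s p∈ p∉m)
          (sym (trans (chosen-unchanged outside-inside p∈ C⇒D₂) (fire-∉ C p∉m))))
          where
          outside-inside : ∀ {k} → Inside k → p ∉ dom k
          outside-inside inside p∈k = p∉m (inside p∈k)
        D₁≋D₂ : proj₁ comp₁ ≋ proj₁ comp₂
        D₁≋D₂ = merge (_∈ dom m) (<-wellFounded _)
          (chosen-reachable reachD D⇒D₁) (chosen-reachable (reachable-step reach s′) C⇒D₂)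
          (chosen-positioned posD D⇒D₁) (chosen-positioned posC′ C⇒D₂)
          agree (leave (proj₂ (proj₂ comp₁))) (leave (proj₂ (proj₂ comp₂)))

  -- Construction of rankings from runs.

  open Ranking
  open Strategy

  infix 4 _⊑_
  _⊑_ : Ranking → Ranking → Set
  ρ ⊑ ρ′ = ∀ {m} → Ranked ρ m → Ranked ρ′ m

  empty-ranking : Ranking
  empty-ranking = record
    { choice      = λ _ → nothing
    ; rank        = λ _ → 0
    ; bound       = 0
    ; rank≤bound  = λ _ → z≤n
    ; choice-node = λ ()
    ; choice-out  = λ ()
    ; choice-next = λ ()
    }

  module Extend (ρ : Ranking) {m b} (unranked : ¬ Ranked ρ m) (node : IsNode m) (out : Out m b)
                (next : ∀ {p} → p ∈ dom m → ∃[ k ] δ m b p ≡ ⁅ k ⁆ × Ranked ρ k) where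

    choice′ : Fin K → Maybe R
    choice′ k = if does (k ≟ m) then just b else choice ρ k

    -- `suc (bound ρ)` exceeds all old ranks, so the new choice at `m` descends, its successors
    -- being ranked already. Ranked nodes keep their ranks because `m` was not among them.
    rank′ : Subset K → ℕ
    rank′ s = if does (s ≟ˢ ⁅ m ⁆) then suc (bound ρ) else rank ρ s

    rank′-old : ∀ {k} → k ≢ m → rank′ ⁅ k ⁆ ≡ rank ρ ⁅ k ⁆
    rank′-old {k} k≢m rewrite dec-false (⁅ k ⁆ ≟ˢ ⁅ m ⁆) (k≢m ∘ ⁅⁆-injective) = refl

    rank′-new : rank′ ⁅ m ⁆ ≡ suc (bound ρ)
    rank′-new rewrite dec-true (⁅ m ⁆ ≟ˢ ⁅ m ⁆) refl = refl

    rank′≤ : ∀ s → rank′ s ≤ suc (bound ρ)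
    rank′≤ s with s ≟ˢ ⁅ m ⁆
    ... | yes _ = ℕ.≤-refl
    ... | no  _ = ℕ.m≤n⇒m≤1+n (rank≤bound ρ s)

    Ranked′ : Fin K → Set
    Ranked′ k = k ≡ fin ⊎ ∃[ c ] choice′ k ≡ just c

    ranked-mono : ∀ {k} → Ranked ρ k → Ranked′ k
    ranked-mono (inj₁ eq) = inj₁ eq
    ranked-mono {k} (inj₂ c) with k ≟ m
    ... | yes _ = inj₂ (b , refl)
    ... | no  _ = inj₂ c

    ranked-new : Ranked′ m
    ranked-new rewrite dec-true (m ≟ m) refl = inj₂ (b , refl)

    ranked-≢ : ∀ {k} → Ranked ρ k → k ≢ m
    ranked-≢ ranked refl = unranked ranked

    choice′-node : ∀ {k c} → choice′ k ≡ just c → IsNode k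
    choice′-node {k} eq with k ≟ m
    ... | yes refl = node
    ... | no  _    = choice-node ρ eq

    choice′-out : ∀ {k c} → choice′ k ≡ just c → Out k c
    choice′-out {k} eq with k ≟ m
    choice′-out {k} refl | yes refl = out
    ... | no  _    = choice-out ρ eq

    choice′-next : ∀ {k c p} → choice′ k ≡ just c → p ∈ dom k →
      ∃[ j ] δ k c p ≡ ⁅ j ⁆ × Ranked′ j × rank′ ⁅ j ⁆ < rank′ ⁅ k ⁆
    choice′-next {k} eq p∈k with k ≟ m
    choice′-next refl p∈k | yes refl =
      let (j , δ≡ , ranked) = next p∈k in j , δ≡ , ranked-mono ranked ,
        subst₂ _<_ (sym (rank′-old (ranked-≢ ranked))) (sym rank′-new) (s≤s (rank≤bound ρ _))
    choice′-next eq p∈k | no k≢m =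
      let (j , δ≡ , ranked , j<k) = choice-next ρ eq p∈k in j , δ≡ , ranked-mono ranked ,
        subst₂ _<_ (sym (rank′-old (ranked-≢ ranked))) (sym (rank′-old k≢m)) j<k

    extended : Ranking
    extended = record
      { choice      = choice′
      ; rank        = rank′
      ; bound       = suc (bound ρ)
      ; rank≤bound  = rank′≤
      ; choice-node = choice′-node
      ; choice-out  = choice′-out
      ; choice-next = choice′-next
      }

  -- Reading a successful run backwards, a node that is not yet ranked takes the
  -- outcome of its last occurrence: all nodes occurring later are already ranked.
  rank-run : ∀ {C w} → Determined C → Run N C w (C-fin N) → (ρ : Ranking) →
    ∃[ ρ′ ] ρ ⊑ ρ′ × RankedRun ρ′ w × Positioned ρ′ C
  rank-run det ([] C≋fin) ρ = ρ , id , [] , λ p∈ → fin , C≋fin p∈ , inj₁ refl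
  rank-run {C} det (_∷_ {D = D} {ℓ = m , b} s r) ρ with rank-run (determined-step deterministic s det) r ρ
  ... | ρ₁ , ρ⊑ρ₁ , ranks , pos with ranked? ρ₁ m
  ...   | yes ranked = ρ₁ , ρ⊑ρ₁ , ranked ∷ ranks , positioned-before ρ₁ {C} det s ranked pos
  ...   | no unranked = extended , (λ {k} x → ranked-mono (ρ⊑ρ₁ x)) , ranked-new ∷ All.map ranked-mono ranks ,
                        positioned-before extended {C} det s ranked-new
                          λ p∈ → let (k , eq , x) = pos p∈ in k , eq , ranked-mono x
    where
    next : ∀ {p} → p ∈ dom m → ∃[ k ] δ m b p ≡ ⁅ k ⁆ × Ranked ρ₁ k
    next p∈m with pos (dom-⊆ (proj₁ (enabled s)) p∈m)
    ... | k , eq , x = k , trans (sym (moved s p∈m)) eq , x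
    open Extend ρ₁ unranked (proj₁ (enabled s)) (outcome s) next

  -- Extending a given ranking allows one ranking to cover two runs. Rankings are read off runs into
  -- `C-fin`, so the run is completed first; the added part shows that `F` is positioned.
  rank-prefix : ∀ {C F u} → Reachable N C → Run N C u F → (ρ : Ranking) →
    ∃[ ρ′ ] ρ ⊑ ρ′ × RankedRun ρ′ u × Positioned ρ′ F
  rank-prefix reach r ρ with completes (reachable-run reach r)
  ... | w , r′ with rank-run (determined reach) (run-++ r r′) ρ
  ...   | ρ′ , ρ⊑ρ′ , ranks , _ = ρ′ , ρ⊑ρ′ , ++⁻ˡ _ ranks ,
      run-positioned ρ′ (determined (reachable-run reach r)) r′ (++⁻ʳ _ ranks) λ _ → fin , refl , inj₁ refl

  -- Existence and uniqueness of the ends of maximal runs.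

  module _ {Q : Fin K → Set} (Q? : Decidable Q) (closed : Closed Q) (¬Q-fin : ¬ Q fin) where

    completion : ∀ {C} → Reachable N C → ∃[ F ] ∃[ u ] All (Q ∘ proj₁) u × Run N C u F × Maximal Q F
    completion {C} reach with completes reach
    ... | w , r with rank-run (determined reach) r empty-ranking
    ...   | ρ , _ , _ , pos with chosen-completion ρ Q? ¬Q-fin (<-wellFounded _) pos
    ...     | F , C⇒F , max with chosen-run ρ C⇒F
    ...       | u , qs , r′ = F , u , qs , r′ , max

    -- With one ranking covering both runs, chosen runs lead to `F` and to `G`. By confluence a
    -- chosen run leads from `F` to `G`, and it is empty because `F` enables nothing in `Q`.
    maximal-unique : ∀ {C F G u v} → Reachable N C →
      Run N C u F → All (Q ∘ proj₁) u → Maximal Q F →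
      Run N C v G → All (Q ∘ proj₁) v → Maximal Q G → F ≋ G
    maximal-unique {C} {F} {G} reach r qs maxF r′ qs′ maxG with rank-prefix reach r empty-ranking
    ... | ρ₁ , _ , ranks , posF with rank-prefix reach r′ ρ₁
    ...   | ρ , ρ₁⊑ρ , ranks′ , posG = F≋G (chosen-residual ρ posC C⇒G maxG C⇒F)
      where
      posF′ : Positioned ρ F
      posF′ p∈ = let (k , eq , x) = posF p∈ in k , eq , ρ₁⊑ρ x
      ranks″ = All.map ρ₁⊑ρ ranks
      posC : Positioned ρ C
      posC = run-positioned ρ (determined reach) r ranks″ posF′
      C⇒F = follow-strategy ρ closed ¬Q-fin reach r qs ranks″ posF′ maxF
      C⇒G = follow-strategy ρ closed ¬Q-fin reach r′ qs′ ranks′ posG maxG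
      F≋G : ChosenRun ρ Q F G → F ≋ G
      F≋G ([] F≋G)                   = F≋G
      F≋G (chosen-step q eq s ∷ _) = contradiction q (maxF (enabled s))

    -- Under the strategy every process in dom m ends up strictly below the rank of m.
    leaves-forever : ∀ {C F u m p} → Reachable N C → Run N C u F → All (Q ∘ proj₁) u → Maximal Q F →
      Enabled N C m → Q m → p ∈ dom m → F p ≢ C p
    leaves-forever {C} {F} {m = m} {p} reach r qs max en q p∈m Fp≡Cp with rank-prefix reach r empty-ranking
    ... | ρ , _ , ranks , posF = ℕ.<-irrefl (cong (rank ρ) Fp≡Cp) (ℕ.≤-<-trans
           (chosen-rank-≤ ρ (positioned-after ρ posC s eq)
             (chosen-residual-step ρ posC C⇒F max (chosen-step q eq s)) (dom-⊆ (proj₁ en) p∈m))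
           (rank-< ρ posC s eq p∈m))
      where
      posC : Positioned ρ C
      posC = run-positioned ρ (determined reach) r ranks posF
      C⇒F = follow-strategy ρ closed ¬Q-fin reach r qs ranks posF max
      choose = allowed-choice ρ Q? ¬Q-fin (enabled-ranked ρ {C} posC en) q
      eq = proj₂ choose
      s = fire-step en (choice-out ρ eq)

-- The diagram N|ℓ is a deterministic negotiation diagram.

module Restriction {P K : ℕ} {R : Set} {N : Diagram P K R} (isN : IsNegotiation N)
                   (sound : Sound N) (deterministic : Deterministic N)
                   {n : Fin K} {a : R} (out-a : Diagram.Out N n a)
                   {I F : Config N} (isI : IsI N n I) (isF : IsF N n a I F) where
  open Diagram N
  open IsNegotiation isN
  open Runs isN
  open SoundDeterministic isN sound deterministic

  N′ : Diagram P (suc K) R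
  N′ = restrict N n a I F

  Inner : Fin K → Set
  Inner m = dom m ⊂ dom n

  inner-closed : Closed Inner
  inner-closed (m⊆n , p , p∈n , p∉m) k⊆m = (λ p∈k → m⊆n (k⊆m p∈k)) , p , p∈n , λ p∈k → p∉m (k⊆m p∈k)

  n-isNode : IsNode n
  n-isNode = proj₁ (IsI.enabled isI)

  ¬inner-fin : ¬ Inner fin
  ¬inner-fin (_ , p , p∈n , p∉fin) = p∉fin (subst (p ∈_) (sym dom-fin) (dom-⊆ n-isNode p∈n))

  strict-run : ∀ {u} → All (Inner ∘ proj₁) u → Run N I ((n , a) ∷ u) F → StrictRun N n a I F u
  strict-run qs r = (id , qs) , r

  -- The transition function of N|ℓ as an operation on sets of nodes, so that it applies to the
  -- values of configurations as well.
  retarget : Fin P → Subset K → Subset (suc K)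
  retarget p s = if does (s ≟ˢ F p) then ⁅ zero ⁆ else outside ∷ s

  retarget-final : ∀ {p s} → s ≡ F p → retarget p s ≡ ⁅ zero ⁆
  retarget-final {p} {s} eq rewrite dec-true (s ≟ˢ F p) eq = refl

  retarget-∋⁺ : ∀ {m p s} → m ∈ s → s ≢ F p → suc m ∈ retarget p s
  retarget-∋⁺ {p = p} {s} m∈s s≢F rewrite dec-false (s ≟ˢ F p) s≢F = there m∈s

  retarget-∋⁻ : ∀ {m p s} → suc m ∈ retarget p s → m ∈ s × s ≢ F p
  retarget-∋⁻ {m} {p} {s} m∈ with s ≟ˢ F p
  retarget-∋⁻ {m} m∈ | yes s≡F with x∈⁅y⁆⇒x≡y zero m∈
  ... | ()
  retarget-∋⁻ {m} (there m∈s) | no s≢F = m∈s , s≢F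

  out-valid : ∀ {m b} → Diagram.Out N′ (suc m) b → IsNode m × Out m b
  out-valid (inj₁ (refl , refl))     = n-isNode , out-a
  out-valid (inj₂ (u , (_ , r) , ∈u)) = location-valid r (there ∈u)

  out-occurs : ∀ {m b} → Diagram.Out N′ (suc m) b →
    ∃[ u ] StrictRun N n a I F u × (m , b) List.∈ (n , a) ∷ u
  out-occurs (inj₁ (refl , refl))    = let (u , r) = IsF.reached isF in u , r , here refl
  out-occurs (inj₂ (u , r , ∈u)) = u , r , there ∈u

  deterministic′ : Deterministic N′
  deterministic′ {zero}          _ ()
  deterministic′ {suc m} {b} {p} _ out p∈m with δ m b p ≟ˢ F p
  ... | yes _ = inj₁ (zero , refl)
  ... | no  _ with deterministic (proj₁ (out-valid out)) (proj₂ (out-valid out)) p∈m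
  ...   | inj₁ (k , eq) = inj₁ (suc k , cong (outside ∷_) eq)
  ...   | inj₂ empty    = inj₂ λ { (suc k , there k∈) → empty (k , k∈) }

  δ-singleton : ∀ {m b p k j} → IsNode m → Out m b → p ∈ dom m → k ∈ δ m b p → j ∈ δ m b p → k ≡ j
  δ-singleton node out p∈m k∈ j∈ with deterministic node out p∈m
  ... | inj₁ (_ , eq) = trans (∈-singleton eq k∈) (sym (∈-singleton eq j∈))
  ... | inj₂ empty    = contradiction (_ , k∈) empty

  isNode′-dom-⊆ : ∀ {m} → Diagram.IsNode N′ m → Diagram.dom N′ m ⊆ dom n
  isNode′-dom-⊆ {zero}  _           = id
  isNode′-dom-⊆ {suc m} (inj₁ refl) = id
  isNode′-dom-⊆ {suc m} (inj₂ (_ , _ , ((_ , inner) , _) , ∈u)) = proj₁ (All.lookup inner ∈u)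

  -- For an old node `k`, take a strict run in which `(m , b)` occurs. As `δ m b p` differs from
  -- `F p`, process `p` moves again, through a node of the singleton `δ m b p`, which is therefore
  -- `k`.
  δ-closed′ : ∀ {m b p k} → Diagram.IsNode N′ m → Diagram.Out N′ m b → p ∈ Diagram.dom N′ m →
    k ∈ Diagram.δ N′ m b p → Diagram.IsNode N′ k × p ∈ Diagram.dom N′ k
  δ-closed′ {zero}  _    ()
  δ-closed′ {suc m} {k = zero} node out p∈m _ = _ , isNode′-dom-⊆ {suc m} node p∈m
  δ-closed′ {suc m} {k = suc k} node out p∈m k∈′ with retarget-∋⁻ k∈′ | out-valid {m} out
  ... | k∈ , δ≢F | nodeₘ , outₘ = node-k , proj₂ (δ-closed nodeₘ outₘ p∈m k∈)
    where
    node-k : Diagram.IsNode N′ (suc k)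
    node-k with out-occurs {m} out
    ... | u , strict , ∈u with stays-or-moves-after (proj₂ strict) (dom-⊆ nodeₘ p∈m) ∈u p∈m
    ...   | inj₁ δ≡F = contradiction δ≡F δ≢F
    ...   | inj₂ (j , c , ∈u′ , j∈) with δ-singleton nodeₘ outₘ p∈m k∈ j∈ | ∈u′
    ...     | refl | here refl  = inj₁ refl
    ...     | refl | there ∈u″  = inj₂ (c , u , strict , ∈u″)

  isNegotiation′ : IsNegotiation N′
  isNegotiation′ = record
    { init-isNode  = inj₁ refl
    ; fin-isNode   = _
    ; dom-⊆        = λ {m} → isNode′-dom-⊆ {m}
    ; dom-nonempty = λ {m} → nonempty′ {m}
    ; dom-init     = refl
    ; dom-fin      = refl
    ; δ-closed     = λ {m} → δ-closed′ {m}
    ; out-nonempty = λ {m} → out-nonempty′ {m}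
    ; out-fin      = id
    }
    where
    nonempty′ : ∀ {m} → Diagram.IsNode N′ m → Nonempty (Diagram.dom N′ m)
    nonempty′ {zero}  _                 = dom-nonempty n-isNode
    nonempty′ {suc m} (inj₁ refl)       = dom-nonempty n-isNode
    nonempty′ {suc m} (inj₂ (_ , occ))  = dom-nonempty (proj₁ (out-valid {m} (inj₂ occ)))
    out-nonempty′ : ∀ {m} → Diagram.IsNode N′ m → m ≢ zero → ∃ (Diagram.Out N′ m)
    out-nonempty′ {zero}  _                m≢fin = contradiction refl m≢fin
    out-nonempty′ {suc m} (inj₁ refl)      _     = a , inj₁ (refl , refl)
    out-nonempty′ {suc m} (inj₂ (b , occ)) _     = b , inj₂ occ

  -- Correspondence of runs of N|ℓ with strict runs of N.

  module R′ = Runs isNegotiation′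

  -- A process that is in its place in `F` is regarded as waiting at the new final node.
  lift : Config N → Config N′
  lift D p = retarget p (D p)

  lift-step : ∀ {C D m b} → Diagram.IsNode N′ (suc m) → Diagram.Out N′ (suc m) b →
    Step N C (m , b) D → (∀ {p} → p ∈ dom m → C p ≢ F p) → Step N′ (lift C) (suc m , b) (lift D)
  lift-step node out s C≢F = record
    { enabled   = node , λ p∈m → retarget-∋⁺ (proj₂ (enabled s) p∈m) (C≢F p∈m)
    ; outcome   = out
    ; moved     = λ p∈m → cong (retarget _) (moved s p∈m)
    ; unchanged = λ p∈ p∉m → cong (retarget _) (unchanged s (dom-⊆ n-isNode p∈) p∉m)
    }
    where open Step

  Intermediate : Config N → Set
  Intermediate D = ∃[ w ] All (Inner ∘ proj₁) w × Run N I ((n , a) ∷ w) D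

  intermediate-step : ∀ {C D m b} → Intermediate C → Inner m → Step N C (m , b) D → Intermediate D
  intermediate-step (w , qs , r) q s = w ++ _ , ++⁺ qs (q ∷ []) , run-++ r (s ∷ [] (λ _ → refl))

  intermediate-reachable : ∀ {D} → Intermediate D → Reachable N D
  intermediate-reachable (_ , _ , r) = reachable-run (IsI.reachable isI) r

  -- `completion` extends the strict run to a maximal one, and `maximal-unique` identifies its end
  -- with `F`.
  completes-to-F : ∀ {D} → Intermediate D → ∃[ u ] All (Inner ∘ proj₁) u × Run N D u F
  completes-to-F {D} mid@(w , ws , first ∷ r)
    with completion (λ m → dom m ⊂? dom n) inner-closed ¬inner-fin (intermediate-reachable mid) | IsF.reached isF
  ... | G , u , us , r′ , max | v , (_ , vs) , first′ ∷ r″ =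
    u , us , subst (λ v → Run N D v F) (++-identityʳ u) (run-++ r′ ([] G≋F))
    where
    -- The runs are compared after `(n , a)`, as `n` itself is not `Inner`.
    G≋F = maximal-unique (λ m → dom m ⊂? dom n) inner-closed ¬inner-fin
            (reachable-step (IsI.reachable isI) first)
            (run-++ r r′) (++⁺ ws us) max
            (run-respˡ r″ (step-functional first′ first λ _ → refl)) vs (IsF.maximal isF)

  -- `leaves-forever` applies to a completion of `D` to `F`. Hence redirection to the new final node
  -- never blocks an enabled strict node.
  enabled-not-final : ∀ {D m p} → Intermediate D → Enabled N D m → Inner m → p ∈ dom m → D p ≢ F p
  enabled-not-final mid en q p∈m D≡F with completes-to-F mid
  ... | u , us , r = leaves-forever (λ m → dom m ⊂? dom n) inner-closed ¬inner-fin
        (intermediate-reachable mid) r us (IsF.maximal isF) en q p∈m (sym D≡F)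

  lift-run : ∀ {D u} → Intermediate D → All (Inner ∘ proj₁) u → Run N D u F →
    ∃[ u′ ] Run N′ (lift D) u′ (C-fin N′)
  lift-run mid [] ([] D≋F) = [] , [] λ p∈ → retarget-final (D≋F (dom-⊆ n-isNode p∈))
  lift-run {u = (m , b) ∷ u} mid@(w , ws , r) (q ∷ qs) (s ∷ r′) with lift-run (intermediate-step mid q s) qs r′
  ... | u′ , r″ = (suc m , b) ∷ u′ , s′ ∷ r″
    where
    -- The prefix `w`, this step and the remaining run form one strict run to `F`.
    occurs : Occurs N n a I F (m , b)
    occurs = w ++ (m , b) ∷ u , strict-run (++⁺ ws (q ∷ qs)) (run-++ r (s ∷ r′)) , ∈-++⁺ʳ w (here refl)
    s′ = lift-step (inj₂ (b , occurs)) (inj₂ occurs) s (enabled-not-final mid (Step.enabled s) q)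

  -- Were `n` enabled, `dom n` would wait at `n` short of `F`. A completion to `F` would then start
  -- with an inner node sharing a process with `n`, hence with `n` itself.
  n-not-enabled-again : ∀ {D} → Intermediate D → ¬ Enabled N′ (lift D) (suc n)
  n-not-enabled-again {D} mid (_ , en) with completes-to-F mid
  ... | [] , _ , [] D≋F = let (p , p∈n) = dom-nonempty n-isNode in
        proj₂ (retarget-∋⁻ (en p∈n)) (D≋F (dom-⊆ n-isNode p∈n))
  ... | (m , _) ∷ _ , inner ∷ _ , s ∷ _ = ⊂-irref (cong dom m≡n) inner
    where
    p = proj₁ (dom-nonempty (proj₁ (Step.enabled s)))
    p∈m = proj₂ (dom-nonempty (proj₁ (Step.enabled s)))
    p∈n = proj₁ inner p∈m
    m≡n : m ≡ n
    m≡n = ∈-singleton (determined-at {D} (determined (intermediate-reachable mid)) (dom-⊆ n-isNode p∈n)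
            (proj₁ (retarget-∋⁻ (en p∈n)))) (proj₂ (Step.enabled s) p∈m)

  -- Enabledness in `lift C` implies enabledness in `C`, and `Occurs` makes `m` strict. The step is
  -- replayed in `N`, lifted, and compared with the given one by functionality.
  project-step : ∀ {C E ℓ} → Intermediate C → Step N′ (lift C) ℓ E →
    ∃[ D ] Intermediate D × (lift D R′.≋ E)
  project-step {ℓ = zero , _}  mid s = ⊥-elim (Step.outcome s)
  project-step {C} {E} {suc m , b} mid s with Step.outcome s
  ... | inj₁ (refl , _) = ⊥-elim (n-not-enabled-again mid (Step.enabled s))
  ... | inj₂ (u , strict@((_ , inner) , r) , ∈u) =
    fire C m b , intermediate-step mid q t , R′.step-functional s′ s λ _ → refl
    where
    q = All.lookup inner ∈u
    valid = location-valid r (there ∈u)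
    t : Step N C (m , b) (fire C m b)
    t = fire-step (proj₁ valid , λ p∈m → proj₁ (retarget-∋⁻ (proj₂ (Step.enabled s) p∈m))) (proj₂ valid)
    s′ = lift-step (inj₂ (b , u , strict , ∈u)) (inj₂ (u , strict , ∈u)) t
           λ p∈m → proj₂ (retarget-∋⁻ (proj₂ (Step.enabled s) p∈m))

  project-run : ∀ {C E w} → Intermediate C → Run N′ (lift C) w E → ∃[ D ] Intermediate D × (lift D R′.≋ E)
  project-run {C} mid ([] C≋E) = C , mid , C≋E
  project-run {C} mid (s ∷ r) with project-step mid s
  ... | D , mid′ , D≋ = project-run mid′ (R′.run-respˡ r λ p∈ → sym (D≋ p∈))

  -- The run is projected to `N`, completed there to `F`, and the completion is lifted back.
  intermediate-completes : ∀ {C E w} → Intermediate C → Run N′ (lift C) w E → ∃[ w′ ] Run N′ E w′ (C-fin N′)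
  intermediate-completes mid r with project-run mid r
  ... | D , mid′ , D≋E with completes-to-F mid′
  ...   | u , us , r′ with lift-run mid′ us r′
  ...     | w′ , r″ = w′ , R′.run-respˡ r″ D≋E

  -- The first step and soundness of N|ℓ.

  J : Config N
  J = fire I n a

  intermediate-J : Intermediate J
  intermediate-J = [] , [] , fire-step (IsI.enabled isI) out-a ∷ [] λ _ → refl

  -- The first step is treated separately because the initial configuration need not be `lift I`:
  -- `F` may agree with `I` at a process, for instance if `(n , a)` loops back to `n`.
  first-step : Step N′ (C-init N′) (suc n , a) (lift J)
  first-step = record
    { enabled   = inj₁ refl , λ _ → x∈⁅x⁆ (suc n)
    ; outcome   = inj₁ (refl , refl)
    ; moved     = λ p∈n → cong (retarget _) (fire-∈ I p∈n)
    ; unchanged = λ p∈n p∉n → contradiction p∈n p∉n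
    }

  -- Only `n` is enabled. An outcome of `n` from `Occurs` would place `n` in the strict part of a
  -- sequence, where domains are smaller than `dom n`.
  first-location : ∀ {ℓ D} → Step N′ (C-init N′) ℓ D → ℓ ≡ (suc n , a)
  first-location {zero , _}  s = ⊥-elim (Step.outcome s)
  first-location {suc m , b} s with IsNegotiation.dom-nonempty isNegotiation′ {suc m} (proj₁ (Step.enabled s))
  ... | p , p∈m with x∈⁅y⁆⇒x≡y (suc n) (proj₂ (Step.enabled s) p∈m) | Step.outcome s
  ...   | refl | inj₁ (_ , refl) = refl
  ...   | refl | inj₂ (_ , ((_ , inner) , _) , ∈u) = ⊥-elim (⊂-irref refl (All.lookup inner ∈u))

  sound′ : Sound N′
  sound′ [] C r with intermediate-completes intermediate-J ([] λ _ → refl)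
  ... | w′ , r′ = (suc n , a) ∷ w′ , first-step ∷ r′
  sound′ (_ ∷ w) C (s ∷ r) with first-location s
  ... | refl with R′.step-functional s first-step (λ _ → refl)
  ...   | D≋J with intermediate-completes intermediate-J (R′.run-respˡ r D≋J)
  ...     | w′ , r′ = w′ , s ∷ R′.run-++ r r′

lemma6 : ∀ {P K : ℕ} {R : Set} (N : Diagram P K R) →
    IsNegotiation N → Sound N → Deterministic N →
    (n : Fin K) → ReachableNode N n →
    (a : R) → Diagram.Out N n a →
    (I F : Config N) → IsI N n I → IsF N n a I F →
    IsNegotiation (restrict N n a I F)
    × Sound (restrict N n a I F)
    × Deterministic (restrict N n a I F)
lemma6 N isN sound det n _ a out-a I F isI isF = isNegotiation′ , sound′ , λ {m} → deterministic′ {m}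
  where open Restriction isN sound det out-a isI isF
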